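{- Let $D$ be a multipartite tournament having exactly two partite sets that are not $\{1,2\}$-competing. Then the following are equivalent: (i) $C_{1,2}(D)$ is an interval graph; (ii) $C_{1,2}(D)$ is chordal; (iii) $C_{1,2}(D)$ has no induced cycle of length four. In particular, if all partite sets of $D$ except possibly one have at most three vertices, then $C_{1,2}(D)$ is an interval graph.
   Context: All graphs and digraphs are finite and simple. For a digraph $D$, $d_D(x,y)$ is the length of a shortest directed path from $x$ to $y$. The $(1,2)$-step competition graph $C_{1,2}(D)$ is the graph on $V(D)$ in which distinct $u,v$ are adjacent iff there is a vertex $w\notin\{u,v\}$ with either $d_{D-v}(u,w)\le 1$ and $d_{D-u}(v,w)\le 2$, or $d_{D-u}(v,w)\le 1$ and $d_{D-v}(u,w)\le 2$. A multipartite tournament is an orientation of a complete $k$-partite graph for some $k\ge3$ (with nonempty partite sets). A set of vertices is $\{1,2\}$-competing if it is a clique in $C_{1,2}(D)$. A graph is an interval graph if its vertices can be assigned real intervals so that two distinct vertices are adjacent iff their intervals intersect; it is chordal if it has no induced cycle of length at least four. -}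

module Defs where

open import Data.Nat using (ℕ; zero; suc; _≤_; _<_)
open import Data.Fin using (Fin; toℕ)
open import Data.Bool using (Bool; T)
open import Data.List using (List; length; filter)
open import Data.Fin using (_≟_)
open import Data.List using (allFin)
open import Data.Product using (Σ; _×_; _,_; ∃)
open import Data.Sum using (_⊎_)
open import Data.Empty using (⊥)
open import Relation.Nullary using (¬_)
open import Relation.Binary.PropositionalEquality using (_≡_; _≢_)
open import Data.Rational using (ℚ) renaming (_≤_ to _≤ℚ_)

record Digraph (n : ℕ) : Set where
  field
    arc   : Fin n → Fin n → Bool
    irrefl : ∀ v → ¬ T (arc v v)
open Digraph public

-- A graph on Fin n: symmetric irreflexive adjacency relation.
Graph : ℕ → Set₁
Graph n = Fin n → Fin n → Set

-- ReachAvoid D a k u w : there is a directed walk from u to w of length ≤ k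
-- in D - a (all vertices of the walk, including u, differ from a).
-- Equivalently d_{D-a}(u,w) ≤ k (for u ≠ a).
data ReachAvoid {n : ℕ} (D : Digraph n) (a : Fin n) : ℕ → Fin n → Fin n → Set where
  here : ∀ {k u} → u ≢ a → ReachAvoid D a k u u
  step : ∀ {k u x w} → u ≢ a → T (arc D u x) →
         ReachAvoid D a k x w → ReachAvoid D a (suc k) u w

C12 : ∀ {n} → Digraph n → Graph n
C12 D u v =
  u ≢ v × ∃ λ w → w ≢ u × w ≢ v ×
    ((ReachAvoid D v 1 u w × ReachAvoid D u 2 v w)
     ⊎ (ReachAvoid D u 1 v w × ReachAvoid D v 2 u w))

record IsMultipartiteTournament {n : ℕ} (D : Digraph n) (k : ℕ) (part : Fin n → Fin k) : Set where
  field
    three≤k    : 3 ≤ k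
    nonempty   : ∀ i → ∃ λ v → part v ≡ i
    noArcInside : ∀ u v → part u ≡ part v → ¬ T (arc D u v)
    someArc    : ∀ u v → part u ≢ part v → T (arc D u v) ⊎ T (arc D v u)
    notBoth    : ∀ u v → ¬ (T (arc D u v) × T (arc D v u))

IsClique : ∀ {n} → Graph n → (Fin n → Set) → Set
IsClique G S = ∀ u v → S u → S v → u ≢ v → G u v

Competing : ∀ {n} → Digraph n → (Fin n → Set) → Set
Competing D S = IsClique (C12 D) S

PartSet : ∀ {n k} → (Fin n → Fin k) → Fin k → Fin n → Set
PartSet part i v = part v ≡ i

partSize : ∀ {n k} → (Fin n → Fin k) → Fin k → ℕ
partSize part i = length (filter (λ v → part v ≟ i) (allFin _))

IsInterval : ∀ {n} → Graph n → Set
IsInterval {n} G =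
  Σ (Fin n → ℚ) λ l → Σ (Fin n → ℚ) λ r →
    (∀ v → l v ≤ℚ r v) ×
    (∀ u v → u ≢ v → (G u v → (l u ≤ℚ r v × l v ≤ℚ r u))
                   × ((l u ≤ℚ r v × l v ≤ℚ r u) → G u v))

CycAdj : ∀ {m} → Fin m → Fin m → Set
CycAdj {m} i j =
  suc (toℕ i) ≡ toℕ j ⊎ suc (toℕ j) ≡ toℕ i
  ⊎ (toℕ i ≡ 0 × suc (toℕ j) ≡ m) ⊎ (toℕ j ≡ 0 × suc (toℕ i) ≡ m)

InducedCycle : ∀ {n} → Graph n → (m : ℕ) → Set
InducedCycle {n} G m =
  Σ (Fin m → Fin n) λ c →
    (∀ i j → c i ≡ c j → i ≡ j) ×
    (∀ i j → i ≢ j → (G (c i) (c j) → CycAdj i j) × (CycAdj i j → G (c i) (c j)))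

IsChordal : ∀ {n} → Graph n → Set
IsChordal G = ∀ m → 4 ≤ m → ¬ InducedCycle G m

NoInducedC4 : ∀ {n} → Graph n → Set
NoInducedC4 G = ¬ InducedCycle G 4

ExactlyTwoNonCompeting : ∀ {n k} → Digraph n → (Fin n → Fin k) → Set
ExactlyTwoNonCompeting D part =
  ∃ λ i → ∃ λ j → i ≢ j ×
    ¬ Competing D (PartSet part i) × ¬ Competing D (PartSet part j) ×
    (∀ l → l ≢ i → l ≢ j → Competing D (PartSet part l))

{-# OPTIONS --safe #-}

-- Call two vertices parallel when they are distinct and not adjacent in C₁₂(D).  Let P and Q be
-- the two parts containing parallel pairs.  Every vertex outside Q dominates a member of each
-- parallel pair of Q, and vice versa; hence every vertex with a parallel partner lies in P with
-- all its out-neighbours in Q, or in Q with all its out-neighbours in P.  Two such vertices on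
-- the same side are parallel iff their out-neighbourhoods are disjoint; on opposite sides, iff
-- one is the only out-neighbour of the other.
--
-- Without an induced 4-cycle, any two parallel pairs are joined by a further parallel pair.
-- Applied to a pair of P and a pair of Q, this gives (up to symmetry) a vertex of P whose only
-- out-neighbour p lies in Q.  Sorting the vertices by their relation to p orients parallelism
-- as an interval order, and C₁₂(D) is its incomparability graph.  Conversely, two unjoined
-- parallel pairs force at least four vertices in each of P and Q.

module Submission where

open import Defs
open import Data.Bool using (T)
open import Data.Bool.Properties using (T?)
open import Data.Empty using (⊥; ⊥-elim)
open import Data.Fin using (Fin; zero; suc; toℕ; fromℕ<; _≟_)
open import Data.Fin.Patterns using (0F; 1F; 2F; 3F)
open import Data.Fin.Properties using (toℕ<n; toℕ-fromℕ<; any?; all?; ¬∀⟶∃¬; injective⇒≤)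
open import Data.Fin.Subset using (Subset; _∈_; ∣_∣)
open import Data.Fin.Subset.Properties using (p⊆q⇒∣p∣≤∣q∣; p⊂q⇒∣p∣<∣q∣)
open import Data.Integer using (+_; +≤+)
open import Data.List using (lookup; allFin; filter)
open import Data.List.Membership.Propositional using () renaming (_∈_ to _∈ˡ_)
open import Data.List.Membership.Propositional.Properties using (∈-filter⁺; ∈-allFin)
open import Data.List.Relation.Unary.Any.Properties using (lookup-index)
open import Data.Nat using (ℕ; zero; suc; _+_; _≤_; _<_; s≤s; z≤n)
open import Data.Nat.Coprimality using (1-coprimeTo) renaming (sym to coprime-sym)
open import Data.Nat.Properties using (≤-antisym; <-trans; n<1+n; n≤1+n; <⇒≱; ≮⇒≥; _<?_; 1+n≢n; ≤-refl)
open import Data.Product using (_×_; _,_; ∃; proj₁; proj₂)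
open import Data.Rational using (ℚ; mkℚ; *≤*) renaming (_≤_ to _≤ℚ_)
open import Data.Rational.Properties using () renaming (≤-refl to ≤ℚ-refl; ≤-trans to ≤ℚ-trans; ≤-total to ≤ℚ-total)
open import Data.Sum using (_⊎_; inj₁; inj₂; swap; [_,_]′)
open import Data.Vec using (tabulate)
open import Data.Vec.Properties using (lookup∘tabulate; lookup⇒[]=; []=⇒lookup)
open import Function using (_∘_; case_of_)
open import Function.Bundles using (_⇔_; mk⇔)
open import Relation.Nullary using (¬_; Dec; yes; no; does; contradiction)
open import Relation.Nullary.Decidable using (_×-dec_; _⊎-dec_; _→-dec_; ¬?; map′; dec-true; decidable-stable)
open import Relation.Unary using (Decidable)
open import Relation.Binary.PropositionalEquality using (_≡_; _≢_; refl; sym; trans; cong; subst; ≢-sym)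
import Data.Integer.Properties as ℤ

-- Subsets cut out by decidable predicates, and naturals as rationals

module _ {n : ℕ} {P : Fin n → Set} (P? : Decidable P) where

  subsetOf : Subset n
  subsetOf = tabulate (does ∘ P?)

  ∈-subsetOf⁺ : ∀ {x} → P x → x ∈ subsetOf
  ∈-subsetOf⁺ {x} px = lookup⇒[]= x subsetOf (trans (lookup∘tabulate (does ∘ P?) x) (dec-true (P? x) px))

  ∈-subsetOf⁻ : ∀ {x} → x ∈ subsetOf → P x
  ∈-subsetOf⁻ {x} x∈ with P? x | trans (sym (lookup∘tabulate (does ∘ P?) x)) ([]=⇒lookup x∈)
  ... | yes px | _ = px
  ... | no _   | ()

fromℕ : ℕ → ℚ
-- `mkℚ` stores the denominator minus one, so `0` encodes denominator one.
fromℕ m = mkℚ (+ m) 0 (coprime-sym (1-coprimeTo m))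

fromℕ-mono : ∀ {m n} → m ≤ n → fromℕ m ≤ℚ fromℕ n
fromℕ-mono {m} {n} m≤n = *≤* (ℤ.*-monoʳ-≤-nonNeg (+ 1) (+≤+ m≤n))

fromℕ-cancel : ∀ {m n} → fromℕ m ≤ℚ fromℕ n → m ≤ n
fromℕ-cancel {m} {n} (*≤* p) = ℤ.drop‿+≤+ (ℤ.*-cancelʳ-≤-pos (+ m) (+ n) (+ 1) p)

-- Interval representations of interval orders

-- By the Ferrers condition the sets Left y and Right x form a chain, and x ≺ y iff Right x ⊆ Left y.
module IntervalOrder {n : ℕ} (_≺_ : Fin n → Fin n → Set)
  (_≺?_ : ∀ x y → Dec (x ≺ y))
  (irreflexive : ∀ x → ¬ x ≺ x)
  (ferrers : ∀ {x y z w} → x ≺ y → z ≺ w → x ≺ w ⊎ z ≺ y) where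

  Left Right : Fin n → Fin n → Set
  Left y z = ∃ λ x → x ≺ y × ¬ x ≺ z
  Right x z = ¬ x ≺ z

  Left? : ∀ y → Decidable (Left y)
  Left? y z = any? λ x → (x ≺? y) ×-dec ¬? (x ≺? z)

  Right? : ∀ x → Decidable (Right x)
  Right? x z = ¬? (x ≺? z)

  left right : Fin n → ℕ
  -- The `suc` makes inclusion of `Right x` in `Left y` yield a strict gap between the closed
  -- intervals, while proper inclusion the other way still yields overlap.
  left y = suc ∣ subsetOf (Left? y) ∣
  right x = ∣ subsetOf (Right? x) ∣

  ≺⇒right<left : ∀ {x y} → x ≺ y → right x < left y
  ≺⇒right<left {x} {y} x≺y = s≤s (p⊆q⇒∣p∣≤∣q∣ λ z∈ →
    ∈-subsetOf⁺ (Left? y) (x , x≺y , ∈-subsetOf⁻ (Right? x) z∈))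

  -- `Left y` is contained in `Right x` by the Ferrers condition, and properly so: `y` lies in
  -- `Right x` but never in `Left y`.
  ⊀⇒left≤right : ∀ {x y} → ¬ x ≺ y → left y ≤ right x
  ⊀⇒left≤right {x} {y} x⊀y = p⊂q⇒∣p∣<∣q∣
    ((λ z∈ → ∈-subsetOf⁺ (Right? x) (Left⊆Right (∈-subsetOf⁻ (Left? y) z∈)))
    , y , ∈-subsetOf⁺ (Right? x) x⊀y
    , λ y∈ → let _ , p , ¬p = ∈-subsetOf⁻ (Left? y) y∈ in ¬p p)
    where
    Left⊆Right : ∀ {z} → Left y z → Right x z
    Left⊆Right (v , v≺y , v⊀z) x≺z = [ v⊀z , x⊀y ]′ (ferrers v≺y x≺z)

  incomparability⇒interval : (G : Graph n) →
    (∀ u v → u ≢ v → (G u v → ¬ u ≺ v × ¬ v ≺ u) × (¬ u ≺ v → ¬ v ≺ u → G u v)) →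
    IsInterval G
  incomparability⇒interval G G⇔ = fromℕ ∘ left , fromℕ ∘ right
    , (λ v → fromℕ-mono (⊀⇒left≤right (irreflexive v)))
    , λ u v u≢v →
        (λ g → let u⊀v , v⊀u = proj₁ (G⇔ u v u≢v) g in
               fromℕ-mono (⊀⇒left≤right v⊀u) , fromℕ-mono (⊀⇒left≤right u⊀v))
      , (λ (p , q) → proj₂ (G⇔ u v u≢v)
          (λ u≺v → <⇒≱ (≺⇒right<left u≺v) (fromℕ-cancel q))
          (λ v≺u → <⇒≱ (≺⇒right<left v≺u) (fromℕ-cancel p)))

-- Cycle neighbours, and chordality of interval graphs

argmin : ∀ {m} (f : Fin (suc m) → ℚ) → ∃ λ i → ∀ j → f i ≤ℚ f j
argmin {zero} f = zero , λ { zero → ≤ℚ-refl }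
argmin {suc m} f with argmin (f ∘ suc)
... | i , min with ≤ℚ-total (f zero) (f (suc i))
...   | inj₁ p = zero , λ { zero → ≤ℚ-refl ; (suc j) → ≤ℚ-trans p (min j) }
...   | inj₂ p = suc i , λ { zero → p ; (suc j) → min j }

CycAdjℕ : ℕ → ℕ → ℕ → Set
CycAdjℕ m s t = suc s ≡ t ⊎ suc t ≡ s ⊎ (s ≡ 0 × suc t ≡ m) ⊎ (t ≡ 0 × suc s ≡ m)

-- Length at least four keeps the two neighbours of a vertex from being adjacent. The cases are the
-- first vertex, an interior one, and the last one, where the cycle wraps around.
cycle-neighboursℕ : ∀ k t → t < 4 + k → ∃ λ a → ∃ λ b → a < 4 + k × b < 4 + k ×
  CycAdjℕ (4 + k) t a × CycAdjℕ (4 + k) t b × a ≢ b × ¬ CycAdjℕ (4 + k) a b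
cycle-neighboursℕ k zero _ = 1 , 3 + k , s≤s (s≤s z≤n) , ≤-refl
  , inj₁ refl , inj₂ (inj₂ (inj₁ (refl , refl))) , (λ ())
  , λ { (inj₁ ()) ; (inj₂ (inj₁ ())) ; (inj₂ (inj₂ (inj₁ ()))) ; (inj₂ (inj₂ (inj₂ ()))) }
cycle-neighboursℕ k (suc t) t< with suc (suc t) <? 4 + k
... | yes t+2< = t , 2 + t , <-trans (n<1+n t) t< , t+2<
  , inj₂ (inj₁ refl) , inj₁ refl , (λ ())
  , λ { (inj₁ ()) ; (inj₂ (inj₁ ())) ; (inj₂ (inj₂ (inj₁ (refl , ())))) ; (inj₂ (inj₂ (inj₂ ()))) }
... | no t+2≮ with ≤-antisym t< (≮⇒≥ t+2≮)
...   | refl = 2 + k , 0 , n≤1+n _ , s≤s z≤n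
  , inj₂ (inj₁ refl) , inj₂ (inj₂ (inj₂ (refl , refl))) , (λ ())
  , λ { (inj₁ ()) ; (inj₂ (inj₁ ())) ; (inj₂ (inj₂ (inj₁ ()))) ; (inj₂ (inj₂ (inj₂ (_ , ())))) }

cycle-neighbours : ∀ k (i : Fin (4 + k)) → ∃ λ a → ∃ λ b →
  CycAdj i a × CycAdj i b × a ≢ b × ¬ CycAdj a b
cycle-neighbours k i with cycle-neighboursℕ k (toℕ i) (toℕ<n i)
... | a , b , a< , b< , ia , ib , a≢b , ¬ab
  rewrite sym (toℕ-fromℕ< a<) | sym (toℕ-fromℕ< b<)
  = fromℕ< a< , fromℕ< b< , ia , ib , a≢b ∘ cong toℕ , ¬ab

CycAdj-irreflexive : ∀ {k} {i : Fin (4 + k)} → ¬ CycAdj i i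
CycAdj-irreflexive (inj₁ e) = 1+n≢n e
CycAdj-irreflexive (inj₂ (inj₁ e)) = 1+n≢n e
CycAdj-irreflexive {i = zero} (inj₂ (inj₂ (inj₁ (_ , ()))))
CycAdj-irreflexive {i = zero} (inj₂ (inj₂ (inj₂ (_ , ()))))

CycAdj-sym : ∀ {m} {i j : Fin m} → CycAdj i j → CycAdj j i
CycAdj-sym (inj₁ e) = inj₂ (inj₁ e)
CycAdj-sym (inj₂ (inj₁ e)) = inj₁ e
CycAdj-sym (inj₂ (inj₂ (inj₁ e))) = inj₂ (inj₂ (inj₂ e))
CycAdj-sym (inj₂ (inj₂ (inj₂ e))) = inj₂ (inj₂ (inj₁ e))

¬CycAdj-0-2 : ¬ CycAdj {4} 0F 2F
¬CycAdj-0-2 (inj₁ ())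
¬CycAdj-0-2 (inj₂ (inj₁ ()))
¬CycAdj-0-2 (inj₂ (inj₂ (inj₁ (_ , ()))))
¬CycAdj-0-2 (inj₂ (inj₂ (inj₂ (() , _))))

¬CycAdj-1-3 : ¬ CycAdj {4} 1F 3F
¬CycAdj-1-3 (inj₁ ())
¬CycAdj-1-3 (inj₂ (inj₁ ()))
¬CycAdj-1-3 (inj₂ (inj₂ (inj₁ (() , _))))
¬CycAdj-1-3 (inj₂ (inj₂ (inj₂ (() , _))))

-- Both cycle neighbours of the interval ending first contain its right endpoint.
interval⇒chordal : ∀ {n} {G : Graph n} → IsInterval G → IsChordal G
interval⇒chordal (l , r , _ , G⇔) _ (s≤s (s≤s (s≤s (s≤s {n = k} _)))) (c , inj , adj)
  with argmin (r ∘ c)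
... | i , min with cycle-neighbours k i
...   | a , b , ia , ib , a≢b , ¬ab =
  ¬ab (proj₁ (adj a b a≢b) (proj₂ (G⇔ (c a) (c b) (a≢b ∘ inj a b))
    (≤ℚ-trans (start ia) (min b) , ≤ℚ-trans (start ib) (min a))))
  where
  start : ∀ {j} → CycAdj i j → l (c j) ≤ℚ r (c i)
  start {j} ij = proj₂ (proj₁ (G⇔ (c i) (c j) (i≢j ∘ inj i j)) (proj₂ (adj i j i≢j) ij))
    where
    i≢j : i ≢ j
    i≢j refl = CycAdj-irreflexive ij

-- Families of four vertices, and sizes of parts

quad : {A : Set} → A → A → A → A → Fin 4 → A
quad a b c d 0F = a
quad a b c d 1F = b
quad a b c d 2F = c
quad a b c d 3F = d

quad-injective : {A : Set} {a b c d : A} → a ≢ b → a ≢ c → a ≢ d → b ≢ c → b ≢ d → c ≢ d →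
  ∀ i j → quad a b c d i ≡ quad a b c d j → i ≡ j
quad-injective {a = a} {b} {c} {d} ab ac ad bc bd cd = go
  where
  go : ∀ i j → quad a b c d i ≡ quad a b c d j → i ≡ j
  go 0F 0F _ = refl
  go 0F 1F e = contradiction e ab
  go 0F 2F e = contradiction e ac
  go 0F 3F e = contradiction e ad
  go 1F 0F e = contradiction (sym e) ab
  go 1F 1F _ = refl
  go 1F 2F e = contradiction e bc
  go 1F 3F e = contradiction e bd
  go 2F 0F e = contradiction (sym e) ac
  go 2F 1F e = contradiction (sym e) bc
  go 2F 2F _ = refl
  go 2F 3F e = contradiction e cd
  go 3F 0F e = contradiction (sym e) ad
  go 3F 1F e = contradiction (sym e) bd
  go 3F 2F e = contradiction (sym e) cd
  go 3F 3F _ = refl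

-- The position of `f t` in the filtered list determines `f t` by lookup, so `t` is determined by
-- that position.
injective⇒≤partSize : ∀ {n k m} (part : Fin n → Fin k) {j} (f : Fin m → Fin n) →
  (∀ s t → f s ≡ f t → s ≡ t) → (∀ t → part (f t) ≡ j) → m ≤ partSize part j
injective⇒≤partSize part {j} f inj f∈j = injective⇒≤ λ {s} {t} e →
  inj s t (trans (lookup-index (mem s)) (trans (cong (lookup members) e) (sym (lookup-index (mem t)))))
  where
  members = filter (λ v → part v ≟ j) (allFin _)
  mem : ∀ t → f t ∈ˡ members
  mem t = ∈-filter⁺ (λ v → part v ≟ j) (∈-allFin (f t)) (f∈j t)

-- Nonadjacent pairs and induced 4-cycles

module Nonadjacency {n : ℕ} (G : Graph n)
  (G-sym : ∀ {x y} → G x y → G y x) (G? : ∀ x y → Dec (G x y)) where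

  infix 4 _∥_ _∥?_

  _∥_ : Fin n → Fin n → Set
  x ∥ y = x ≢ y × ¬ G x y

  ∥-sym : ∀ {x y} → x ∥ y → y ∥ x
  ∥-sym (x≢y , ¬g) = ≢-sym x≢y , ¬g ∘ G-sym

  _∥?_ : ∀ x y → Dec (x ∥ y)
  x ∥? y = ¬? (x ≟ y) ×-dec ¬? (G? x y)

  ¬∥⇒G : ∀ {x y} → x ≢ y → ¬ x ∥ y → G x y
  ¬∥⇒G {x} {y} x≢y ¬∥ = decidable-stable (G? x y) λ ¬g → ¬∥ (x≢y , ¬g)

  -- An induced 4-cycle x z y w is a pair of disjoint nonedges xy, zw with no nonedge between.
  noC₄⇒linked : NoInducedC4 G → ∀ {x y z w} → x ∥ y → z ∥ w →
    (x ∥ z ⊎ y ∥ w) ⊎ (x ∥ w ⊎ z ∥ y)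
  noC₄⇒linked noC₄ {x} {y} {z} {w} xy zw
    with x ∥? z | y ∥? w | x ∥? w | z ∥? y
  ... | yes p | _     | _     | _     = inj₁ (inj₁ p)
  ... | no _  | yes p | _     | _     = inj₁ (inj₂ p)
  ... | no _  | no _  | yes p | _     = inj₂ (inj₁ p)
  ... | no _  | no _  | no _  | yes p = inj₂ (inj₂ p)
  ... | no ¬xz | no ¬yw | no ¬xw | no ¬zy = ⊥-elim (noC₄
    ( quad x z y w
    , quad-injective x≢z (proj₁ xy) x≢w z≢y (proj₁ zw) y≢w
    , λ i j i≢j → adj i j i≢j , adj⁻ i j))
    where
    -- If the two nonedges shared a vertex, one of them would itself be one of the excluded links.
    x≢z : x ≢ z
    x≢z refl = ¬xw zw
    x≢w : x ≢ w
    x≢w refl = ¬xz (∥-sym zw)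
    z≢y : z ≢ y
    z≢y refl = ¬yw zw
    y≢w : y ≢ w
    y≢w refl = ¬xw xy
    xz = ¬∥⇒G x≢z ¬xz
    xw = ¬∥⇒G x≢w ¬xw
    zy = ¬∥⇒G z≢y ¬zy
    yw = ¬∥⇒G y≢w ¬yw
    adj : ∀ i j → i ≢ j → G (quad x z y w i) (quad x z y w j) → CycAdj i j
    adj 0F 0F i≢j _ = contradiction refl i≢j
    adj 0F 1F _ _ = inj₁ refl
    adj 0F 2F _ g = contradiction g (proj₂ xy)
    adj 0F 3F _ _ = inj₂ (inj₂ (inj₁ (refl , refl)))
    adj 1F 0F _ _ = inj₂ (inj₁ refl)
    adj 1F 1F i≢j _ = contradiction refl i≢j
    adj 1F 2F _ _ = inj₁ refl
    adj 1F 3F _ g = contradiction g (proj₂ zw)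
    adj 2F 0F _ g = contradiction (G-sym g) (proj₂ xy)
    adj 2F 1F _ _ = inj₂ (inj₁ refl)
    adj 2F 2F i≢j _ = contradiction refl i≢j
    adj 2F 3F _ _ = inj₁ refl
    adj 3F 0F _ _ = inj₂ (inj₂ (inj₂ (refl , refl)))
    adj 3F 1F _ g = contradiction (G-sym g) (proj₂ zw)
    adj 3F 2F _ _ = inj₂ (inj₁ refl)
    adj 3F 3F i≢j _ = contradiction refl i≢j
    adj⁻ : ∀ i j → CycAdj i j → G (quad x z y w i) (quad x z y w j)
    adj⁻ 0F 0F ij = ⊥-elim (CycAdj-irreflexive {0} {i = 0F} ij)
    adj⁻ 0F 1F _ = xz
    adj⁻ 0F 2F ij = ⊥-elim (¬CycAdj-0-2 ij)
    adj⁻ 0F 3F _ = xw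
    adj⁻ 1F 0F _ = G-sym xz
    adj⁻ 1F 1F ij = ⊥-elim (CycAdj-irreflexive {0} {i = 1F} ij)
    adj⁻ 1F 2F _ = zy
    adj⁻ 1F 3F ij = ⊥-elim (¬CycAdj-1-3 ij)
    adj⁻ 2F 0F ij = ⊥-elim (¬CycAdj-0-2 (CycAdj-sym ij))
    adj⁻ 2F 1F _ = G-sym zy
    adj⁻ 2F 2F ij = ⊥-elim (CycAdj-irreflexive {0} {i = 2F} ij)
    adj⁻ 2F 3F _ = yw
    adj⁻ 3F 0F _ = G-sym xw
    adj⁻ 3F 1F ij = ⊥-elim (¬CycAdj-1-3 (CycAdj-sym ij))
    adj⁻ 3F 2F _ = G-sym yw
    adj⁻ 3F 3F ij = ⊥-elim (CycAdj-irreflexive {0} {i = 3F} ij)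

  -- The diagonals of the cycle are the two nonedges, and its sides are the four edges between them.
  C₄⇒unlinked : InducedCycle G 4 → ∃ λ x → ∃ λ y → ∃ λ z → ∃ λ w →
    x ∥ y × z ∥ w × G x z × G x w × G z y × G y w
  C₄⇒unlinked (c , inj , adj) = c 0F , c 2F , c 1F , c 3F
    , ((λ e → case inj 0F 2F e of λ ()) , ¬CycAdj-0-2 ∘ proj₁ (adj 0F 2F (λ ())))
    , ((λ e → case inj 1F 3F e of λ ()) , ¬CycAdj-1-3 ∘ proj₁ (adj 1F 3F (λ ())))
    , proj₂ (adj 0F 1F (λ ())) (inj₁ refl)
    , proj₂ (adj 0F 3F (λ ())) (inj₂ (inj₂ (inj₁ (refl , refl))))
    , proj₂ (adj 1F 2F (λ ())) (inj₁ refl)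
    , proj₂ (adj 2F 3F (λ ())) (inj₁ refl)

-- Adjacency in the competition graph, expressed by arcs

module Competition {n : ℕ} (D : Digraph n) where

  infix 4 _⇒_

  _⇒_ : Fin n → Fin n → Set
  x ⇒ y = T (arc D x y)

  _⇒?_ : ∀ x y → Dec (x ⇒ y)
  x ⇒? y = T? (arc D x y)

  ⇒-irrefl : ∀ {x y} → x ⇒ y → x ≢ y
  ⇒-irrefl a refl = irrefl D _ a

  C12-sym : ∀ {x y} → C12 D x y → C12 D y x
  C12-sym (x≢y , w , w≢x , w≢y , e) = ≢-sym x≢y , w , w≢y , w≢x , swap e

  reachAvoid? : ∀ a k u w → Dec (ReachAvoid D a k u w)
  reachAvoid? a k u w with u ≟ a
  reachAvoid? a k u w | yes refl = no λ { (here u≢a) → u≢a refl ; (step u≢a _ _) → u≢a refl }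
  reachAvoid? a zero u w | no u≢a = map′ (λ { refl → here u≢a }) (λ { (here _) → refl }) (u ≟ w)
  reachAvoid? a (suc k) u w | no u≢a = map′
    [ (λ { refl → here u≢a }) , (λ (x , ux , xw) → step u≢a ux xw) ]′
    (λ { (here _) → inj₁ refl ; (step _ ux xw) → inj₂ (_ , ux , xw) })
    ((u ≟ w) ⊎-dec any? λ x → (u ⇒? x) ×-dec reachAvoid? a k x w)

  C12? : ∀ x y → Dec (C12 D x y)
  C12? u v = ¬? (u ≟ v) ×-dec any? λ w → ¬? (w ≟ u) ×-dec ¬? (w ≟ v) ×-dec
    ((reachAvoid? v 1 u w ×-dec reachAvoid? u 2 v w)
     ⊎-dec (reachAvoid? u 1 v w ×-dec reachAvoid? v 2 u w))

  C12-common : ∀ {u v w} → u ≢ v → u ⇒ w → v ⇒ w → C12 D u v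
  C12-common u≢v uw vw = u≢v , _ , w≢u , w≢v ,
    inj₁ (step u≢v uw (here w≢v) , step (≢-sym u≢v) vw (here w≢u))
    where
    w≢u = ≢-sym (⇒-irrefl uw)
    w≢v = ≢-sym (⇒-irrefl vw)

  -- The target must lie outside `u` and `v`, and the walk from `v` must avoid `u`; this is what the
  -- last two hypotheses provide.
  C12-two-step : ∀ {u v w x} → u ≢ v → u ⇒ w → v ⇒ x → x ⇒ w → w ≢ v → x ≢ u → C12 D u v
  C12-two-step u≢v uw vx xw w≢v x≢u = u≢v , _ , w≢u , w≢v ,
    inj₁ (step u≢v uw (here w≢v) , step (≢-sym u≢v) vx (step x≢u xw (here w≢u)))
    where w≢u = ≢-sym (⇒-irrefl uw)

  TwoStep : Fin n → Fin n → Set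
  TwoStep u v = ∃ λ w → ∃ λ x → u ⇒ w × v ⇒ x × x ⇒ w × w ≢ v × x ≢ u

  -- Walks of length zero are ruled out because the target differs from both starting points; what
  -- remains is one arc from `u` and one or two arcs from `v`.
  walks-elim : ∀ {u v w} → w ≢ u → w ≢ v → ReachAvoid D v 1 u w → ReachAvoid D u 2 v w →
    (∃ λ w → u ⇒ w × v ⇒ w) ⊎ TwoStep u v
  walks-elim w≢u _ (here _) _ = contradiction refl w≢u
  walks-elim _ w≢v (step _ _ (here _)) (here _) = contradiction refl w≢v
  walks-elim _ _ (step _ uw (here _)) (step _ vw (here _)) = inj₁ (_ , uw , vw)
  walks-elim _ w≢v (step _ uw (here _)) (step _ vx (step x≢u xw (here _))) =
    inj₂ (_ , _ , uw , vx , xw , w≢v , x≢u)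

  C12-elim : ∀ {u v} → C12 D u v → (∃ λ w → u ⇒ w × v ⇒ w) ⊎ TwoStep u v ⊎ TwoStep v u
  C12-elim (_ , _ , w≢u , w≢v , inj₁ (p , q)) = [ inj₁ , inj₂ ∘ inj₁ ]′ (walks-elim w≢u w≢v p q)
  C12-elim (_ , _ , w≢u , w≢v , inj₂ (p , q)) =
    [ (λ (w , vw , uw) → inj₁ (w , uw , vw)) , inj₂ ∘ inj₂ ]′ (walks-elim w≢v w≢u p q)

  Single : Fin n → Fin n → Set
  Single x y = x ⇒ y × (∀ w → x ⇒ w → w ≡ y)

  single? : ∀ x y → Dec (Single x y)
  single? x y = (x ⇒? y) ×-dec all? λ w → (x ⇒? w) →-dec (w ≟ y)

  open Nonadjacency (C12 D) C12-sym C12? public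

  -- Adjacency would give `x` an out-neighbour other than `y`: the common target, or the midpoint of
  -- the two-arc walk from `x`.
  single⇒∥ : ∀ {x y} → Single x y → x ∥ y
  single⇒∥ {x} {y} (xy , only) = ⇒-irrefl xy , λ c → case C12-elim c of λ where
    (inj₁ (w , xw , yw)) → ⇒-irrefl yw (sym (only w xw))
    (inj₂ (inj₁ (w , _ , xw , _ , _ , w≢y , _))) → w≢y (only w xw)
    (inj₂ (inj₂ (_ , v , _ , xv , _ , _ , v≢y))) → v≢y (only v xv)

-- Multipartite tournaments with two noncompeting parts

module Multipartite {n k : ℕ} (D : Digraph n) (part : Fin n → Fin k)
  (mt : IsMultipartiteTournament D k part) where

  open IsMultipartiteTournament mt
  open Competition D

  part-≢ : ∀ {x y i j} → i ≢ j → part x ≡ i → part y ≡ j → x ≢ y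
  part-≢ i≢j refl refl refl = i≢j refl

  part-⇒ : ∀ {x y} → x ⇒ y → part x ≢ part y
  part-⇒ xy e = noArcInside _ _ e xy

  arc-between : ∀ {x y i j} → i ≢ j → part x ≡ i → part y ≡ j → x ⇒ y ⊎ y ⇒ x
  arc-between i≢j refl refl = someArc _ _ i≢j

  PairIn : Fin k → Fin n → Fin n → Set
  PairIn i x y = part x ≡ i × part y ≡ i × x ∥ y

  PairIn-sym : ∀ {i x y} → PairIn i x y → PairIn i y x
  PairIn-sym (x∈ , y∈ , xy) = y∈ , x∈ , ∥-sym xy

  NonEdge : Fin k → Set
  NonEdge i = ∃ λ x → ∃ λ y → PairIn i x y

  -- Otherwise `x` would be a common out-neighbour of the parallel vertices `p` and `q`.
  dominates-one : ∀ {j p q x} → PairIn j p q → part x ≢ j → x ⇒ p ⊎ x ⇒ q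
  dominates-one (p∈ , q∈ , p≢q , ¬pq) x∉
    with arc-between x∉ refl p∈ | arc-between x∉ refl q∈
  ... | inj₁ xp | _       = inj₁ xp
  ... | inj₂ _  | inj₁ xq = inj₂ xq
  ... | inj₂ px | inj₂ qx = contradiction (C12-common p≢q px qx) ¬pq

  dominates : ∀ {j x} → NonEdge j → part x ≢ j → ∃ λ p → ∃ λ q → x ⇒ p × PairIn j p q
  dominates (p , q , pq) x∉ with dominates-one pq x∉
  ... | inj₁ xp = p , q , xp , pq
  ... | inj₂ xq = q , p , xq , PairIn-sym pq

  Inward : Fin k → Fin k → Fin n → Set
  Inward i j x = part x ≡ i × (∀ w → x ⇒ w → part w ≡ j)

  inward? : ∀ i j x → Dec (Inward i j x)
  inward? i j x = (part x ≟ i) ×-dec all? λ w → (x ⇒? w) →-dec (part w ≟ j)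

  ¬inward⇒escape : ∀ {i j x} → part x ≡ i → ¬ Inward i j x → ∃ λ w → x ⇒ w × part w ≢ j
  ¬inward⇒escape {j = j} {x} x∈ ¬in
    with ¬∀⟶∃¬ n (λ w → x ⇒ w → part w ≡ j) (λ w → (x ⇒? w) →-dec (part w ≟ j)) (λ f → ¬in (x∈ , f))
  ... | w , ¬f = w , decidable-stable (x ⇒? w) (λ ¬xw → ¬f (λ xw → contradiction xw ¬xw))
                   , λ e → ¬f (λ _ → e)

  -- A connection through a two-arc walk would need an arc inside part `j`, so only a common
  -- out-neighbour could make `x` and `y` adjacent.
  inward-disjoint⇒∥ : ∀ {i j x y} → Inward i j x → Inward i j y → x ≢ y →
    (∀ w → x ⇒ w → ¬ y ⇒ w) → x ∥ y
  inward-disjoint⇒∥ (_ , x⊆) (_ , y⊆) x≢y disj = x≢y , λ c → case C12-elim c of λ where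
    (inj₁ (w , xw , yw)) → disj w xw yw
    (inj₂ (inj₁ (w , v , xw , yv , vw , _))) → part-⇒ vw (trans (y⊆ v yv) (sym (x⊆ w xw)))
    (inj₂ (inj₂ (w , v , yw , xv , vw , _))) → part-⇒ vw (trans (x⊆ v xv) (sym (y⊆ w yw)))

  ∥⇒disjoint : ∀ {x y w} → x ∥ y → x ⇒ w → ¬ y ⇒ w
  ∥⇒disjoint (x≢y , ¬c) xw yw = ¬c (C12-common x≢y xw yw)

  inward-share : ∀ {i j x y} → Inward i j x → Inward i j y → C12 D x y → ∃ λ w → x ⇒ w × y ⇒ w
  inward-share {x = x} {y} x∈ y∈ c = decidable-stable
    (any? λ w → (x ⇒? w) ×-dec (y ⇒? w))
    λ none → proj₂ (inward-disjoint⇒∥ x∈ y∈ (proj₁ c) (λ w xw yw → none (w , xw , yw))) c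

  module TwoParts {i j : Fin k} (i≢j : i ≢ j) (eᵢ : NonEdge i) (eⱼ : NonEdge j) where

    -- If `x` dominates some `w` outside `j`, take `q` in `j` dominated by `y`. The arc between `w`
    -- and `q`, in either direction, makes `x` and `y` adjacent.
    pair⇒inward : ∀ {x y} → PairIn i x y → Inward i j x
    pair⇒inward {x} {y} (x∈ , y∈ , x≢y , ¬xy) = x∈ , λ w xw →
      decidable-stable (part w ≟ j) λ w∉ → absurd xw w∉
      where
      absurd : ∀ {w} → x ⇒ w → part w ≢ j → ⊥
      absurd {w} xw w∉ with dominates eⱼ (λ e → i≢j (trans (sym y∈) e))
      ... | q , _ , yq , q∈ , _ = [ (λ wq → ¬xy (C12-sym (C12-two-step (≢-sym x≢y) yq xw wq q≢x w≢y)))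
                                  , (λ qw → ¬xy (C12-two-step x≢y xw yq qw w≢y q≢x)) ]′ (arc-between w∉ refl q∈)
        where
        q≢x = ≢-sym (part-≢ i≢j x∈ q∈)
        w≢y : w ≢ y
        w≢y refl = part-⇒ xw (trans x∈ (sym y∈))

    outside⇒pair : ∀ {x y z} → part z ≢ i → part z ≢ j → PairIn i x y → z ⇒ x
    outside⇒pair z∉i z∉j xy with pair⇒inward xy
    ... | x∈ , x⊆ with arc-between z∉i refl x∈
    ...   | inj₁ zx = zx
    ...   | inj₂ xz = contradiction (x⊆ _ xz) z∉j

    -- If `a` also dominates some `w` other than `b`, take `z` in part `i` dominated by `b`. The arc
    -- between `z` and `w`, in either direction, makes `a` and `b` adjacent; `z` is not `a` because
    -- the arc between `a` and `b` leaves `a`.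
    cross-single : ∀ {a b} → Inward i j a → Inward j i b → a ∥ b → a ⇒ b → Single a b
    cross-single {a} {b} (a∈ , a⊆) (b∈ , b⊆) (a≢b , ¬ab) ab = ab , λ w aw →
      decidable-stable (w ≟ b) (absurd aw)
      where
      absurd : ∀ {w} → a ⇒ w → w ≢ b → ⊥
      absurd aw w≢b with dominates eᵢ (λ e → i≢j (trans (sym e) b∈))
      ... | z , _ , bz , z∈ , _ with arc-between i≢j z∈ (a⊆ _ aw)
      ...   | inj₁ zw = ¬ab (C12-two-step a≢b aw bz zw w≢b λ { refl → notBoth _ _ (ab , bz) })
      ...   | inj₂ wz = ¬ab (C12-sym (C12-two-step (≢-sym a≢b) bz aw wz (λ { refl → notBoth _ _ (ab , bz) }) w≢b))

  module BothSides {i j : Fin k} (i≢j : i ≢ j) (eᵢ : NonEdge i) (eⱼ : NonEdge j) where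

    open TwoParts i≢j eᵢ eⱼ
    module Swapped = TwoParts (≢-sym i≢j) eⱼ eᵢ

    -- `x` lies outside one of the two parts and dominates a member of a parallel pair there; `y`
    -- dominates that member too.
    outside-universal : ∀ {x y} → part y ≢ i → part y ≢ j → y ≢ x → C12 D y x
    outside-universal {x} y∉i y∉j y≢x with part x ≟ i
    ... | yes x∈ = let q , _ , xq , qq′ = dominates eⱼ (λ e → i≢j (trans (sym x∈) e)) in
                   C12-common y≢x (Swapped.outside⇒pair y∉j y∉i qq′) xq
    ... | no x∉  = let q , _ , xq , qq′ = dominates eᵢ x∉ in
                   C12-common y≢x (outside⇒pair y∉i y∉j qq′) xq

    -- Suppose `x` dominates some `r` outside `j`. The main case is `y` in `j`: then `y` dominates a
    -- member `z` of a parallel pair of part `i`, and so does `r`, so the walk from `x` through `r`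
    -- meets `y` at `z`.
    ∥⇒inwardᵢ : ∀ {x y} → part x ≡ i → x ∥ y → Inward i j x
    ∥⇒inwardᵢ {x} {y} x∈ xy@(x≢y , ¬xy) with inward? i j x
    ... | yes inw = inw
    ... | no ¬in with ¬inward⇒escape x∈ ¬in
    ...   | r , xr , r∉j with part y ≟ i
    ...     | yes y∈ = contradiction (proj₂ (pair⇒inward (x∈ , y∈ , xy)) r xr) r∉j
    ...     | no y∉i with part y ≟ j
    ...       | no y∉j = contradiction (C12-sym (outside-universal y∉i y∉j (≢-sym x≢y))) ¬xy
    ...       | yes y∈ with dominates eᵢ y∉i
    ...         | z , _ , yz , zz′ = ⊥-elim (¬xy (C12-sym (C12-two-step (≢-sym x≢y) yz xr
                    (outside⇒pair (λ e → part-⇒ xr (trans x∈ (sym e))) r∉j zz′)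
                    (λ { refl → r∉j (proj₂ (pair⇒inward zz′) r xr) })
                    (≢-sym (part-≢ (≢-sym r∉j) y∈ refl)))))

  module NonEdges {i j : Fin k} (i≢j : i ≢ j) (eᵢ : NonEdge i) (eⱼ : NonEdge j) where

    ∥⇒inward : ∀ {x y} → x ∥ y → Inward i j x ⊎ Inward j i x
    ∥⇒inward {x} xy with part x ≟ i | part x ≟ j
    ... | yes x∈ | _      = inj₁ (BothSides.∥⇒inwardᵢ i≢j eᵢ eⱼ x∈ xy)
    ... | no _   | yes x∈ = inj₂ (BothSides.∥⇒inwardᵢ (≢-sym i≢j) eⱼ eᵢ x∈ xy)
    ... | no x∉i | no x∉j =
      contradiction (BothSides.outside-universal i≢j eᵢ eⱼ x∉i x∉j (proj₁ xy)) (proj₂ xy)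

    cross : ∀ {a b} → Inward i j a → Inward j i b → a ∥ b → Single a b ⊎ Single b a
    cross a∈ b∈ ab with arc-between i≢j (proj₁ a∈) (proj₁ b∈)
    ... | inj₁ a⇒b = inj₁ (TwoParts.cross-single i≢j eᵢ eⱼ a∈ b∈ ab a⇒b)
    ... | inj₂ b⇒a = inj₂ (TwoParts.cross-single (≢-sym i≢j) eⱼ eᵢ b∈ a∈ (∥-sym ab) b⇒a)

  -- The interval order built around a vertex with a single out-neighbour

  data Class : Set where
    cU cO cA cP : Class

  module SingleOut (noC₄ : NoInducedC4 (C12 D)) {i j : Fin k} (i≢j : i ≢ j) {u u′ p p′ : Fin n}
    (uu′ : PairIn i u u′) (pp′ : PairIn j p p′) (up : Single u p) where

    open NonEdges i≢j (u , u′ , uu′) (p , p′ , pp′)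

    u-inward : Inward i j u
    u-inward = TwoParts.pair⇒inward i≢j (u , u′ , uu′) (p , p′ , pp′) uu′

    p-inward : Inward j i p
    p-inward = TwoParts.pair⇒inward (≢-sym i≢j) (p , p′ , pp′) (u , u′ , uu′) pp′

    -- Class `cO` takes all remaining vertices, among them every vertex without a parallel partner.
    data View (x : Fin n) : Class → Set where
      isU : Inward i j x → Single x p → View x cU
      isA : Inward i j x → p ⇒ x → View x cA
      isP : x ≡ p → View x cP
      isO : x ≢ p → ¬ (Inward i j x × Single x p) → ¬ (Inward i j x × p ⇒ x) → View x cO

    view : ∀ x → ∃ (View x)
    view x with x ≟ p | inward? i j x ×-dec single? x p | inward? i j x ×-dec (p ⇒? x)
    ... | yes e | _             | _             = cP , isP e
    ... | no _  | yes (x∈ , xp) | _             = cU , isU x∈ xp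
    ... | no _  | no _          | yes (x∈ , px) = cA , isA x∈ px
    ... | no ¬P | no ¬U         | no ¬A         = cO , isO ¬P ¬U ¬A

    O-inward⇒p : ∀ {x} → Inward i j x → ¬ (Inward i j x × p ⇒ x) → x ⇒ p
    O-inward⇒p x∈ ¬A with arc-between i≢j (proj₁ x∈) (proj₁ p-inward)
    ... | inj₁ xp = xp
    ... | inj₂ px = contradiction (x∈ , px) ¬A

    A⇒p′ : ∀ {x} → Inward i j x → p ⇒ x → x ⇒ p′
    A⇒p′ x∈ px with dominates-one pp′ (λ e → i≢j (trans (sym (proj₁ x∈)) e))
    ... | inj₁ xp = ⊥-elim (notBoth _ _ (xp , px))
    ... | inj₂ xp′ = xp′

    u-arc : ∀ {x} → Inward j i x → x ≢ p → x ⇒ u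
    u-arc x∈ x≢p with arc-between i≢j (proj₁ u-inward) (proj₁ x∈)
    ... | inj₁ ux = contradiction (proj₂ up _ ux) x≢p
    ... | inj₂ xu = xu

    -- Common out-neighbours do the work: `p` within `cU`, `p′` within `cA`, and within `cO` either
    -- `p` (side `i`) or `u` (side `j`).
    same-class : ∀ {x y c} → View x c → View y c → ¬ x ∥ y
    same-class (isU _ (xp , _)) (isU _ (yp , _)) xy = ∥⇒disjoint xy xp yp
    same-class (isA x∈ px) (isA y∈ py) xy = ∥⇒disjoint xy (A⇒p′ x∈ px) (A⇒p′ y∈ py)
    same-class (isP refl) (isP refl) (x≢y , _) = x≢y refl
    same-class {x} {y} (isO x≢p x∉U x∉A) (isO y≢p y∉U y∉A) xy
      with ∥⇒inward xy | ∥⇒inward (∥-sym xy)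
    ... | inj₁ x∈ | inj₁ y∈ = ∥⇒disjoint xy (O-inward⇒p x∈ x∉A) (O-inward⇒p y∈ y∉A)
    ... | inj₂ x∈ | inj₂ y∈ = ∥⇒disjoint xy (u-arc x∈ x≢p) (u-arc y∈ y≢p)
    -- Here `x` dominates `p` and `y` dominates `u`, so a sole out-neighbour would force `y` to be
    -- `p` or `x` to be `u`, neither of which lies in `cO`.
    ... | inj₁ x∈ | inj₂ y∈ = case cross x∈ y∈ xy of λ where
      (inj₁ (_ , only)) → y≢p (sym (only p (O-inward⇒p x∈ x∉A)))
      (inj₂ (_ , only)) → x∉U (x∈ , subst (λ v → Single v p) (only u (u-arc y∈ y≢p)) up)
    ... | inj₂ x∈ | inj₁ y∈ = case cross y∈ x∈ (∥-sym xy) of λ where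
      (inj₁ (_ , only)) → x≢p (sym (only p (O-inward⇒p y∈ y∉A)))
      (inj₂ (_ , only)) → y∉U (y∈ , subst (λ v → Single v p) (only u (u-arc x∈ x≢p)) up)

    U∥A : ∀ {x y} → View x cU → View y cA → x ∥ y
    U∥A (isU x∈ (xp , only)) (isA y∈ py) = inward-disjoint⇒∥ x∈ y∈
      (λ { refl → notBoth _ _ (xp , py) })
      (λ w xw yw → notBoth _ _ (subst (_ ⇒_) (only w xw) yw , py))

    U∥P : ∀ {x y} → View x cU → View y cP → x ∥ y
    U∥P (isU _ xp) (isP refl) = single⇒∥ xp

    -- On side `i`, `y` would share the out-neighbour `p` with `x`. So `y` is on side `j` with `x`
    -- as its only out-neighbour, and `p` does not dominate `x`.
    U∥O⇒P∥O : ∀ {x y} → View x cU → View y cO → x ∥ y → p ∥ y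
    U∥O⇒P∥O (isU x∈ x-single@(xp , only)) (isO y≢p y∉U y∉A) xy with ∥⇒inward (∥-sym xy)
    ... | inj₁ y∈ = ⊥-elim (∥⇒disjoint xy xp (O-inward⇒p y∈ y∉A))
    ... | inj₂ y∈ with cross x∈ y∈ xy
    ...   | inj₁ (xy′ , _) = contradiction (only _ xy′) y≢p
    ...   | inj₂ (_ , only-x) = inward-disjoint⇒∥ p-inward y∈ (≢-sym y≢p)
              λ w pw yw → notBoth _ _ (xp , subst (p ⇒_) (only-x w yw) pw)

    -- Parallelism is oriented by an order on classes. Comparability of the classes of parallel
    -- vertices makes incomparability the same as adjacency.
    module Ordered (_⊏_ : Class → Class → Set) (_⊏?_ : ∀ c d → Dec (c ⊏ d))
      (comparable : ∀ {x y c d} → View x c → View y d → x ∥ y → c ⊏ d ⊎ d ⊏ c)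
      (ferrers : ∀ {x y z w c d e f} → View x c → View y d → View z e → View w f →
        c ⊏ d → e ⊏ f → x ∥ y → z ∥ w → (c ⊏ f × x ∥ w) ⊎ (e ⊏ d × z ∥ y)) where

      _≺_ : Fin n → Fin n → Set
      x ≺ y = proj₁ (view x) ⊏ proj₁ (view y) × x ∥ y

      interval : IsInterval (C12 D)
      interval = IntervalOrder.incomparability⇒interval _≺_
        (λ x y → (proj₁ (view x) ⊏? proj₁ (view y)) ×-dec (x ∥? y))
        (λ { x (_ , x≢x , _) → x≢x refl })
        (λ {x} {y} {z} {w} (cd , xy) (ef , zw) →
          ferrers (proj₂ (view x)) (proj₂ (view y)) (proj₂ (view z)) (proj₂ (view w)) cd ef xy zw)
        (C12 D)
        λ x y x≢y → (λ g → (λ (_ , _ , ¬g) → ¬g g) , λ (_ , _ , ¬g) → ¬g (C12-sym g))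
          , λ x⊀y y⊀x → ¬∥⇒G x≢y λ xy →
              [ (λ cd → x⊀y (cd , xy)) , (λ dc → y⊀x (dc , ∥-sym xy)) ]′
                (comparable (proj₂ (view x)) (proj₂ (view y)) xy)

    -- Without a unique out-neighbour, `p` is adjacent to all of `cA`, so `cA` and `cP` together
    -- serve as one top level above `cU` and `cO`.
    module ManyOut (p-many : ∀ a → ¬ Single p a) where

      A∦P : ∀ {x y} → View x cA → View y cP → ¬ x ∥ y
      A∦P (isA x∈ px) (isP refl) xp with cross x∈ p-inward xp
      ... | inj₁ (x⇒p , _) = notBoth _ _ (x⇒p , px)
      ... | inj₂ s = p-many _ s

      data Top : Class → Set where
        A : Top cA
        P : Top cP

      data _⊏_ : Class → Class → Set where
        UO : cU ⊏ cO
        U⊤ : ∀ {d} → Top d → cU ⊏ d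
        O⊤ : ∀ {d} → Top d → cO ⊏ d

      _⊏?_ : ∀ c d → Dec (c ⊏ d)
      cU ⊏? cU = no λ { (U⊤ ()) }
      cU ⊏? cO = yes UO
      cU ⊏? cA = yes (U⊤ A)
      cU ⊏? cP = yes (U⊤ P)
      cO ⊏? cU = no λ { (O⊤ ()) }
      cO ⊏? cO = no λ { (O⊤ ()) }
      cO ⊏? cA = yes (O⊤ A)
      cO ⊏? cP = yes (O⊤ P)
      cA ⊏? _ = no λ ()
      cP ⊏? _ = no λ ()

      comparable : ∀ {x y c d} → View x c → View y d → x ∥ y → c ⊏ d ⊎ d ⊏ c
      comparable {c = cU} {cU} vx vy xy = contradiction xy (same-class vx vy)
      comparable {c = cU} {cO} _ _ _ = inj₁ UO
      comparable {c = cU} {cA} _ _ _ = inj₁ (U⊤ A)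
      comparable {c = cU} {cP} _ _ _ = inj₁ (U⊤ P)
      comparable {c = cO} {cU} _ _ _ = inj₂ UO
      comparable {c = cO} {cO} vx vy xy = contradiction xy (same-class vx vy)
      comparable {c = cO} {cA} _ _ _ = inj₁ (O⊤ A)
      comparable {c = cO} {cP} _ _ _ = inj₁ (O⊤ P)
      comparable {c = cA} {cU} _ _ _ = inj₂ (U⊤ A)
      comparable {c = cA} {cO} _ _ _ = inj₂ (O⊤ A)
      comparable {c = cA} {cA} vx vy xy = contradiction xy (same-class vx vy)
      comparable {c = cA} {cP} vx vy xy = contradiction xy (A∦P vx vy)
      comparable {c = cP} {cU} _ _ _ = inj₂ (U⊤ P)
      comparable {c = cP} {cO} _ _ _ = inj₂ (O⊤ P)
      comparable {c = cP} {cA} vx vy xy = contradiction (∥-sym xy) (A∦P vy vx)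
      comparable {c = cP} {cP} vx vy xy = contradiction xy (same-class vx vy)

      U∥Top : ∀ {x y d} → Top d → View x cU → View y d → x ∥ y
      U∥Top A = U∥A
      U∥Top P = U∥P

      Top∦Top : ∀ {x y c d} → Top c → Top d → View x c → View y d → ¬ x ∥ y
      Top∦Top A A vx vy xy = same-class vx vy xy
      Top∦Top A P vx vy xy = A∦P vx vy xy
      Top∦Top P A vx vy xy = A∦P vy vx (∥-sym xy)
      Top∦Top P P vx vy xy = same-class vx vy xy

      -- If one pair starts in `cU` and a pair ends at the top, `U∥Top` decides. Only two pairs from
      -- `cU` to `cO`, or two from `cO` to the top, need the absence of 4-cycles, since links inside
      -- a level are impossible.
      ferrers : ∀ {x y z w c d e f} → View x c → View y d → View z e → View w f →
        c ⊏ d → e ⊏ f → x ∥ y → z ∥ w → (c ⊏ f × x ∥ w) ⊎ (e ⊏ d × z ∥ y)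
      ferrers vx vy vz vw UO UO xy zw with noC₄⇒linked noC₄ xy zw
      ... | inj₁ (inj₁ xz) = contradiction xz (same-class vx vz)
      ... | inj₁ (inj₂ yw) = contradiction yw (same-class vy vw)
      ... | inj₂ (inj₁ xw) = inj₁ (UO , xw)
      ... | inj₂ (inj₂ zy) = inj₂ (UO , zy)
      ferrers vx vy vz vw UO (U⊤ t) _ _ = inj₁ (U⊤ t , U∥Top t vx vw)
      ferrers vx vy vz vw UO (O⊤ t) _ _ = inj₁ (U⊤ t , U∥Top t vx vw)
      ferrers vx vy vz vw (U⊤ t) UO _ _ = inj₂ (U⊤ t , U∥Top t vz vy)
      ferrers vx vy vz vw (U⊤ _) (U⊤ t) _ _ = inj₁ (U⊤ t , U∥Top t vx vw)
      ferrers vx vy vz vw (U⊤ _) (O⊤ t) _ _ = inj₁ (U⊤ t , U∥Top t vx vw)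
      ferrers vx vy vz vw (O⊤ t) UO _ _ = inj₂ (U⊤ t , U∥Top t vz vy)
      ferrers vx vy vz vw (O⊤ t) (U⊤ _) _ _ = inj₂ (U⊤ t , U∥Top t vz vy)
      ferrers vx vy vz vw (O⊤ s) (O⊤ t) xy zw with noC₄⇒linked noC₄ xy zw
      ... | inj₁ (inj₁ xz) = contradiction xz (same-class vx vz)
      ... | inj₁ (inj₂ yw) = contradiction yw (Top∦Top s t vy vw)
      ... | inj₂ (inj₁ xw) = inj₁ (O⊤ t , xw)
      ... | inj₂ (inj₂ zy) = inj₂ (O⊤ s , zy)

      interval : IsInterval (C12 D)
      interval = Ordered.interval _⊏_ _⊏?_ comparable ferrers

    -- Now `cA` has no vertex other than `a`, which is parallel to `p`; so `p` cannot share a level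
    -- with `cA` and moves to the bottom, below `cU`.
    module OneOut {a : Fin n} (pa : Single p a) where

      P∥A : ∀ {x} → View x cA → p ∥ x
      P∥A (isA _ px) = subst (p ∥_) (sym (proj₂ pa _ px)) (single⇒∥ pa)

      data AboveP : Class → Set where
        U : AboveP cU
        O : AboveP cO
        A : AboveP cA

      data _⊏_ : Class → Class → Set where
        P⊥ : ∀ {d} → AboveP d → cP ⊏ d
        UO : cU ⊏ cO
        UA : cU ⊏ cA
        OA : cO ⊏ cA

      _⊏?_ : ∀ c d → Dec (c ⊏ d)
      cP ⊏? cU = yes (P⊥ U)
      cP ⊏? cO = yes (P⊥ O)
      cP ⊏? cA = yes (P⊥ A)
      cP ⊏? cP = no λ { (P⊥ ()) }
      cU ⊏? cU = no λ ()
      cU ⊏? cO = yes UO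
      cU ⊏? cA = yes UA
      cU ⊏? cP = no λ ()
      cO ⊏? cU = no λ ()
      cO ⊏? cO = no λ ()
      cO ⊏? cA = yes OA
      cO ⊏? cP = no λ ()
      cA ⊏? _ = no λ ()

      comparable : ∀ {x y c d} → View x c → View y d → x ∥ y → c ⊏ d ⊎ d ⊏ c
      comparable {c = cU} {cU} vx vy xy = contradiction xy (same-class vx vy)
      comparable {c = cU} {cO} _ _ _ = inj₁ UO
      comparable {c = cU} {cA} _ _ _ = inj₁ UA
      comparable {c = cU} {cP} _ _ _ = inj₂ (P⊥ U)
      comparable {c = cO} {cU} _ _ _ = inj₂ UO
      comparable {c = cO} {cO} vx vy xy = contradiction xy (same-class vx vy)
      comparable {c = cO} {cA} _ _ _ = inj₁ OA
      comparable {c = cO} {cP} _ _ _ = inj₂ (P⊥ O)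
      comparable {c = cA} {cU} _ _ _ = inj₂ UA
      comparable {c = cA} {cO} _ _ _ = inj₂ OA
      comparable {c = cA} {cA} vx vy xy = contradiction xy (same-class vx vy)
      comparable {c = cA} {cP} _ _ _ = inj₂ (P⊥ A)
      comparable {c = cP} {cU} _ _ _ = inj₁ (P⊥ U)
      comparable {c = cP} {cO} _ _ _ = inj₁ (P⊥ O)
      comparable {c = cP} {cA} _ _ _ = inj₁ (P⊥ A)
      comparable {c = cP} {cP} vx vy xy = contradiction xy (same-class vx vy)

      -- Any vertex above another one is parallel to `p`, which settles every Ferrers case involving
      -- `cP`.
      below⇒P-below : ∀ {x y z d e} → View x cP → View y d → View z e →
        d ⊏ e → y ∥ z → cP ⊏ e × x ∥ z
      below⇒P-below (isP refl) (isP refl) _ (P⊥ t) yz = P⊥ t , yz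
      below⇒P-below (isP refl) vy vz UO yz = P⊥ O , U∥O⇒P∥O vy vz yz
      below⇒P-below (isP refl) _ vz UA _ = P⊥ A , P∥A vz
      below⇒P-below (isP refl) _ vz OA _ = P⊥ A , P∥A vz

      ferrers : ∀ {x y z w c d e f} → View x c → View y d → View z e → View w f →
        c ⊏ d → e ⊏ f → x ∥ y → z ∥ w → (c ⊏ f × x ∥ w) ⊎ (e ⊏ d × z ∥ y)
      ferrers vx vy vz vw (P⊥ _) ef xy zw = inj₁ (below⇒P-below vx vz vw ef zw)
      ferrers vx vy vz vw UO (P⊥ _) xy zw = inj₂ (below⇒P-below vz vx vy UO xy)
      ferrers vx vy vz vw UA (P⊥ _) xy zw = inj₂ (below⇒P-below vz vx vy UA xy)
      ferrers vx vy vz vw OA (P⊥ _) xy zw = inj₂ (below⇒P-below vz vx vy OA xy)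
      ferrers vx vy vz vw UO UO xy zw with noC₄⇒linked noC₄ xy zw
      ... | inj₁ (inj₁ xz) = contradiction xz (same-class vx vz)
      ... | inj₁ (inj₂ yw) = contradiction yw (same-class vy vw)
      ... | inj₂ (inj₁ xw) = inj₁ (UO , xw)
      ... | inj₂ (inj₂ zy) = inj₂ (UO , zy)
      ferrers vx vy vz vw UO UA xy zw = inj₁ (UA , U∥A vx vw)
      ferrers vx vy vz vw UO OA xy zw = inj₁ (UA , U∥A vx vw)
      ferrers vx vy vz vw UA UO xy zw = inj₂ (UA , U∥A vz vy)
      ferrers vx vy vz vw UA UA xy zw = inj₁ (UA , U∥A vx vw)
      ferrers vx vy vz vw UA OA xy zw = inj₁ (UA , U∥A vx vw)
      ferrers vx vy vz vw OA UO xy zw = inj₂ (UA , U∥A vz vy)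
      ferrers vx vy vz vw OA UA xy zw = inj₂ (UA , U∥A vz vy)
      ferrers vx vy vz vw OA OA xy zw with noC₄⇒linked noC₄ xy zw
      ... | inj₁ (inj₁ xz) = contradiction xz (same-class vx vz)
      ... | inj₁ (inj₂ yw) = contradiction yw (same-class vy vw)
      ... | inj₂ (inj₁ xw) = inj₁ (OA , xw)
      ... | inj₂ (inj₂ zy) = inj₂ (OA , zy)

      interval : IsInterval (C12 D)
      interval = Ordered.interval _⊏_ _⊏?_ comparable ferrers

    interval : IsInterval (C12 D)
    interval with any? (single? p)
    ... | yes (_ , pa) = OneOut.interval pa
    ... | no ¬s        = ManyOut.interval λ a pa → ¬s (a , pa)

  noC₄⇒interval : ∀ {i j} → i ≢ j → NonEdge i → NonEdge j → NoInducedC4 (C12 D) → IsInterval (C12 D)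
  noC₄⇒interval {i} {j} i≢j eᵢ@(_ , _ , uu′) eⱼ@(_ , _ , pp′) noC₄
    -- The four possible links differ only by swapping the members of either pair.
    = case noC₄⇒linked noC₄ (proj₂ (proj₂ uu′)) (proj₂ (proj₂ pp′)) of λ where
        (inj₁ (inj₁ up)) → from-cross uu′ pp′ up
        (inj₁ (inj₂ u′p′)) → from-cross (PairIn-sym uu′) (PairIn-sym pp′) u′p′
        (inj₂ (inj₁ up′)) → from-cross uu′ (PairIn-sym pp′) up′
        (inj₂ (inj₂ pu′)) → from-cross (PairIn-sym uu′) pp′ (∥-sym pu′)
    where
    from-cross : ∀ {a a′ b b′} → PairIn i a a′ → PairIn j b b′ → a ∥ b → IsInterval (C12 D)
    from-cross aa′ bb′ ab with NonEdges.cross i≢j eᵢ eⱼ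
      (TwoParts.pair⇒inward i≢j eᵢ eⱼ aa′) (TwoParts.pair⇒inward (≢-sym i≢j) eⱼ eᵢ bb′) ab
    ... | inj₁ s = SingleOut.interval noC₄ i≢j aa′ bb′ s
    ... | inj₂ s = SingleOut.interval noC₄ (≢-sym i≢j) bb′ aa′ s

  -- Excluding 4-cycles when one of the two parts has at most three vertices

  -- The shape of an induced 4-cycle `x z y w`, diagonals first. The symmetries that follow shorten
  -- the case analysis.
  Unlinked : Fin n → Fin n → Fin n → Fin n → Set
  Unlinked x y z w = x ∥ y × z ∥ w × C12 D x z × C12 D x w × C12 D z y × C12 D y w

  flip-first : ∀ {x y z w} → Unlinked x y z w → Unlinked y x z w
  flip-first (xy , zw , xz , xw , zy , yw) = ∥-sym xy , zw , C12-sym zy , yw , C12-sym xz , xw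

  exchange : ∀ {x y z w} → Unlinked x y z w → Unlinked z w x y
  exchange (xy , zw , xz , xw , zy , yw) = zw , xy , C12-sym xz , zy , xw , C12-sym yw

  flip-second : ∀ {x y z w} → Unlinked x y z w → Unlinked x y w z
  flip-second = exchange ∘ flip-first ∘ exchange

  module Links {i j : Fin k} (i≢j : i ≢ j) (eᵢ : NonEdge i) (eⱼ : NonEdge j) where

    open NonEdges i≢j eᵢ eⱼ

    -- If `b` dominates only `a`, it dominates neither `z` nor `w`, though they are parallel. If `a`
    -- dominates only `b`, whichever of `z`, `w` does not dominate `b` is parallel to `a`.
    cross-same-linked : ∀ {a b z w} → Inward i j a → Inward j i b → Inward i j z → Inward i j w →
      ¬ Unlinked a b z w
    cross-same-linked {a} {b} {z} {w} a∈ b∈ z∈ w∈ (ab , zw , az , aw , zb , bw) with cross a∈ b∈ ab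
    ... | inj₂ (_ , only) =
      [ (λ bz → proj₁ az (sym (only z bz))) , (λ bw′ → proj₁ aw (sym (only w bw′))) ]′
        (dominates-one (proj₁ z∈ , proj₁ w∈ , zw) (λ e → i≢j (trans (sym e) (proj₁ b∈))))
    ... | inj₁ (_ , only) with z ⇒? b
    ...   | yes zb′ = proj₂ (inward-disjoint⇒∥ a∈ w∈ (proj₁ aw)
              λ v av wv → ∥⇒disjoint zw zb′ (subst (w ⇒_) (only v av) wv)) aw
    ...   | no ¬zb = proj₂ (inward-disjoint⇒∥ a∈ z∈ (proj₁ az)
              λ v av zv → ¬zb (subst (z ⇒_) (only v av) zv)) az

    -- Two sole arcs in the same direction make their tails parallel. In opposite directions, the
    -- arc between the two tails violates one of the sole out-neighbours.
    cross-cross-linked : ∀ {a b c d} → Inward i j a → Inward j i b → Inward i j c → Inward j i d →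
      ¬ Unlinked a b c d
    cross-cross-linked {a} {b} {c} {d} a∈ b∈ c∈ d∈ (ab , cd , ac , ad , cb , bd)
      with cross a∈ b∈ ab | cross c∈ d∈ cd
    ... | inj₁ (_ , only-b) | inj₁ (_ , only-d) = proj₂ (inward-disjoint⇒∥ a∈ c∈ (proj₁ ac)
          λ v av cv → proj₁ bd (trans (sym (only-b v av)) (only-d v cv))) ac
    ... | inj₂ (_ , only-a) | inj₂ (_ , only-c) = proj₂ (inward-disjoint⇒∥ b∈ d∈ (proj₁ bd)
          λ v bv dv → proj₁ ac (trans (sym (only-a v bv)) (only-c v dv))) bd
    ... | inj₁ (_ , only-b) | inj₂ (_ , only-c) =
          [ (λ ad′ → proj₁ bd (sym (only-b d ad′))) , (λ da → proj₁ ac (only-c a da)) ]′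
            (arc-between i≢j (proj₁ a∈) (proj₁ d∈))
    ... | inj₂ (_ , only-a) | inj₁ (_ , only-d) =
          [ (λ cb′ → proj₁ bd (only-d b cb′)) , (λ bc → proj₁ ac (sym (only-a c bc))) ]′
            (arc-between i≢j (proj₁ c∈) (proj₁ b∈))

    -- `x` dominates `z` or `w`; were that its only out-neighbour, the two would be parallel.
    two-out : ∀ {x z w} → Inward i j x → PairIn j z w → C12 D x z → C12 D x w →
      ∃ λ s → ∃ λ t → s ≢ t × x ⇒ s × x ⇒ t
    two-out {x} x∈ zw xz xw =
      [ second xz , second xw ]′ (dominates-one zw (λ e → i≢j (trans (sym (proj₁ x∈)) e)))
      where
      second : ∀ {q} → C12 D x q → x ⇒ q → ∃ λ s → ∃ λ t → s ≢ t × x ⇒ s × x ⇒ t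
      second {q} c xq with any? (λ t → (x ⇒? t) ×-dec ¬? (t ≟ q))
      ... | yes (t , xt , t≢q) = t , q , t≢q , xt , xq
      ... | no none = contradiction c (proj₂ (single⇒∥
              (xq , λ t xt → decidable-stable (t ≟ q) λ t≢q → none (t , xt , t≢q))))

  module SmallPart {i j : Fin k} (i≢j : i ≢ j) (eᵢ : NonEdge i) (eⱼ : NonEdge j)
    (small : partSize part j ≤ 3) where

    open NonEdges i≢j eᵢ eⱼ
    open Links i≢j eᵢ eⱼ
    module Flipped = Links (≢-sym i≢j) eⱼ eᵢ

    no-four : ∀ {a b c d} → part a ≡ j → part b ≡ j → part c ≡ j → part d ≡ j →
      a ≢ b → a ≢ c → a ≢ d → b ≢ c → b ≢ d → c ≢ d → ⊥
    no-four {a} {b} {c} {d} a∈ b∈ c∈ d∈ ab ac ad bc bd cd = <⇒≱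
      (injective⇒≤partSize part (quad a b c d) (quad-injective ab ac ad bc bd cd)
        λ { 0F → a∈ ; 1F → b∈ ; 2F → c∈ ; 3F → d∈ })
      small

    apart : ∀ {x y v w} → x ∥ y → x ⇒ v → y ⇒ w → v ≢ w
    apart xy xv yw refl = ∥⇒disjoint xy xv yw

    -- Each side of the 4-cycle has a common out-neighbour in `j`. Any two sides contain the two
    -- ends of a diagonal, whose out-neighbourhoods are disjoint, so the four are distinct.
    all-i-linked : ∀ {x y z w} → Inward i j x → Inward i j y → Inward i j z → Inward i j w →
      ¬ Unlinked x y z w
    all-i-linked x∈ y∈ z∈ w∈ (xy , zw , xz , xw , zy , yw)
      with inward-share x∈ z∈ xz | inward-share x∈ w∈ xw | inward-share z∈ y∈ zy | inward-share y∈ w∈ yw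
    ... | a , xa , za | b , xb , wb | c , zc , yc | d , yd , wd =
      no-four (proj₂ x∈ a xa) (proj₂ x∈ b xb) (proj₂ y∈ c yc) (proj₂ y∈ d yd)
        (apart zw za wb) (apart xy xa yc) (apart xy xa yd)
        (apart xy xb yc) (apart xy xb yd) (apart zw zc wd)

    all-j-linked : ∀ {x y z w} → Inward j i x → Inward j i y → Inward j i z → Inward j i w →
      ¬ Unlinked x y z w
    all-j-linked (x∈ , _) (y∈ , _) (z∈ , _) (w∈ , _) (xy , zw , xz , xw , zy , yw) =
      no-four x∈ y∈ z∈ w∈ (proj₁ xy) (proj₁ xz) (proj₁ xw) (≢-sym (proj₁ zy)) (proj₁ yw) (proj₁ zw)

    -- `x` and `y` have two out-neighbours each in `j`, and being parallel they share none.
    ii-jj-linked : ∀ {x y z w} → Inward i j x → Inward i j y → Inward j i z → Inward j i w →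
      ¬ Unlinked x y z w
    ii-jj-linked x∈ y∈ (z∈ , _) (w∈ , _) (xy , zw , xz , xw , zy , yw)
      with two-out x∈ (z∈ , w∈ , zw) xz xw | two-out y∈ (z∈ , w∈ , zw) (C12-sym zy) yw
    ... | a , b , a≢b , xa , xb | c , d , c≢d , yc , yd =
      no-four (proj₂ x∈ a xa) (proj₂ x∈ b xb) (proj₂ y∈ c yc) (proj₂ y∈ d yd)
        a≢b (apart xy xa yc) (apart xy xa yd) (apart xy xb yc) (apart xy xb yd) c≢d

    cross-linked : ∀ {x y z w} → Inward i j x → Inward j i y →
      Inward i j z ⊎ Inward j i z → Inward i j w ⊎ Inward j i w → ¬ Unlinked x y z w
    cross-linked x∈ y∈ (inj₁ z∈) (inj₁ w∈) = cross-same-linked x∈ y∈ z∈ w∈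
    cross-linked x∈ y∈ (inj₂ z∈) (inj₂ w∈) = Flipped.cross-same-linked y∈ x∈ z∈ w∈ ∘ flip-first
    cross-linked x∈ y∈ (inj₁ z∈) (inj₂ w∈) = cross-cross-linked x∈ y∈ z∈ w∈
    cross-linked x∈ y∈ (inj₂ z∈) (inj₁ w∈) = cross-cross-linked x∈ y∈ w∈ z∈ ∘ flip-second

    linked : ∀ {x y z w} → ¬ Unlinked x y z w
    -- A diagonal with ends on different sides, if there is one, is brought to the front by
    -- symmetry.
    linked un@(xy , zw , _)
      with ∥⇒inward xy | ∥⇒inward (∥-sym xy) | ∥⇒inward zw | ∥⇒inward (∥-sym zw)
    ... | inj₁ x∈ | inj₂ y∈ | z∈ | w∈ = cross-linked x∈ y∈ z∈ w∈ un
    ... | inj₂ x∈ | inj₁ y∈ | z∈ | w∈ = cross-linked y∈ x∈ z∈ w∈ (flip-first un)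
    ... | inj₁ x∈ | inj₁ y∈ | inj₁ z∈ | inj₁ w∈ = all-i-linked x∈ y∈ z∈ w∈ un
    ... | inj₁ x∈ | inj₁ y∈ | inj₂ z∈ | inj₂ w∈ = ii-jj-linked x∈ y∈ z∈ w∈ un
    ... | inj₂ x∈ | inj₂ y∈ | inj₁ z∈ | inj₁ w∈ = ii-jj-linked z∈ w∈ x∈ y∈ (exchange un)
    ... | inj₂ x∈ | inj₂ y∈ | inj₂ z∈ | inj₂ w∈ = all-j-linked x∈ y∈ z∈ w∈ un
    ... | x∈ | y∈ | inj₁ z∈ | inj₂ w∈ = cross-linked z∈ w∈ x∈ y∈ (exchange un)
    ... | x∈ | y∈ | inj₂ z∈ | inj₁ w∈ = cross-linked w∈ z∈ x∈ y∈ (flip-first (exchange un))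

    noC₄ : NoInducedC4 (C12 D)
    noC₄ cyc with C₄⇒unlinked cyc
    ... | _ , _ , _ , _ , un = linked un

  -- From noncompeting parts to the equivalences

  ¬competing⇒nonEdge : ∀ {i} → ¬ Competing D (PartSet part i) → NonEdge i
  ¬competing⇒nonEdge {i} ¬comp = decidable-stable
    (any? λ x → any? λ y → (part x ≟ i) ×-dec (part y ≟ i) ×-dec (x ∥? y))
    λ none → ¬comp λ x y x∈ y∈ x≢y → ¬∥⇒G x≢y λ xy → none (x , y , x∈ , y∈ , xy)

theorem4p9 : ∀ {n k} (D : Digraph n) (part : Fin n → Fin k) →
    IsMultipartiteTournament D k part →
    ExactlyTwoNonCompeting D part →
    ((IsInterval (C12 D) ⇔ IsChordal (C12 D))
    × (IsChordal (C12 D) ⇔ NoInducedC4 (C12 D)))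
    × ((∃ λ i₀ → ∀ l → l ≢ i₀ → partSize part l ≤ 3) → IsInterval (C12 D))
theorem4p9 D part mt (i , j , i≢j , ¬compᵢ , ¬compⱼ , _) =
  ( mk⇔ interval⇒chordal (interval ∘ chordal⇒noC₄)
  , mk⇔ chordal⇒noC₄ (interval⇒chordal ∘ interval))
  , λ (i₀ , small) → interval (small⇒noC₄ i₀ small)
  where
  open Multipartite D part mt
  eᵢ = ¬competing⇒nonEdge ¬compᵢ
  eⱼ = ¬competing⇒nonEdge ¬compⱼ
  interval : NoInducedC4 (C12 D) → IsInterval (C12 D)
  interval = noC₄⇒interval i≢j eᵢ eⱼ
  chordal⇒noC₄ : IsChordal (C12 D) → NoInducedC4 (C12 D)
  chordal⇒noC₄ chordal = chordal 4 ≤-refl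
  small⇒noC₄ : ∀ i₀ → (∀ l → l ≢ i₀ → partSize part l ≤ 3) → NoInducedC4 (C12 D)
  -- At least one of `i` and `j` differs from `i₀`, and one small part among the two suffices.
  small⇒noC₄ i₀ small with i ≟ i₀
  ... | yes refl = SmallPart.noC₄ i≢j eᵢ eⱼ (small j (≢-sym i≢j))
  ... | no i≢i₀  = SmallPart.noC₄ (≢-sym i≢j) eⱼ eᵢ (small i i≢i₀)
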